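{- Let $\alpha=p/q$, where $p,q$ are fixed positive integers with $p<q/2$, and let $0<c\le 1$ be a constant. Let Alice and Bob hold disjoint sets $A$ and $B$, respectively, of elements from $[n]=\{1,2,\ldots,n\}$, where $s=|A|\le |B|=m$. Let $t=s+m$ denote the total number of elements in $A\cup B$, where $t\ge cn$. Assume that $t$, $c$, and $\alpha$ are known to both players. Put $h=\left\lceil\frac{2q}{q-2p}\right\rceil$ and $\ell=\left\lceil\log\frac{12h}{c}\right\rceil$. Then an $(\alpha t,\alpha t)$-mediocre element of $A\cup B$ can be found (by at least one player) by a deterministic protocol with communication complexity $O(\ell\log h)=O(1)$. If both players return an element, each element returned is $(\alpha t,\alpha t)$-mediocre; the elements found by the two players need not be the same.
   Context: Two-party communication model (Yao): Alice knows only $A$ and Bob knows only $B$, together with the public parameters $n,t,c,\alpha$. They exchange bits according to a deterministic protocol: the messages sent so far determine who speaks next, and each message is a function of the speaker's own input and the messages so far. The communication complexity of a protocol is the maximum, over all admissible inputs, of the total number of bits exchanged; local computation is free. Output convention: at the end of the protocol, each player, as a function of his/her own input and the transcript, either returns an element (locally, without having to communicate it to the other player) or returns nothing. "Found by at least one player" means that on every admissible input at least one of the two players returns an element, and each element returned is an $(\alpha t,\alpha t)$-mediocre element of $A\cup B$. Mediocre element: an element of a finite totally ordered set $S$ is $(i,j)$-mediocre if it is neither among the top (i.e., largest) $i$ nor among the bottom (i.e., smallest) $j$ elements of $S$. Floors are omitted in the notation: $(\alpha t,\alpha t)$-mediocre means $(\lfloor\alpha t\rfloor,\lfloor\alpha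 t\rfloor)$-mediocre. Logarithms are in base $2$. The asymptotic notation is for $n\to\infty$ with $p,q,c$ fixed; in particular the $O(1)$ bound is a constant depending on $q$ and $c$ only, independent of $n$ and of the inputs. -}

module Defs where

open import Data.Bool.Base using (Bool)
open import Data.Fin.Base using (Fin)
import Data.Fin.Properties as Fin
open import Data.Fin.Subset using (Subset; _∈_; _∩_; _∪_; ∣_∣; Empty)
open import Data.Integer.Base using (+_)
open import Data.Maybe using (Maybe; Is-just)
open import Data.Maybe.Relation.Unary.All using (All)
open import Data.Nat.Base
  using (ℕ; suc; NonZero; >-nonZero; _+_; _*_; _∸_; _^_; _/_; _≤_; _<_)
open import Data.Nat.Properties using (m<n⇒0<n∸m)
open import Data.Product.Base using (_×_; _,_; ∃-syntax)
open import Data.Rational.Base as ℚ using (ℚ; 0ℚ)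
open import Data.Sum.Base using (_⊎_)
open import Data.Vec.Base using (tabulate)
open import Function.Bundles using (_⇔_)
open import Relation.Binary.PropositionalEquality using (_≡_)
open import Relation.Nullary using (¬_; does)

-- Dedekind reals: q is in the lower cut of x iff q < x, in the upper cut iff x < q.

record ℝ : Set₁ where
  field
    Lower Upper     : ℚ → Set
    lower-inhabited : ∃[ q ] Lower q
    upper-inhabited : ∃[ q ] Upper q
    lower-rounded   : ∀ q → Lower q ⇔ (∃[ r ] (q ℚ.< r × Lower r))
    upper-rounded   : ∀ q → Upper q ⇔ (∃[ r ] (r ℚ.< q × Upper r))
    disjoint        : ∀ q → ¬ (Lower q × Upper q)
    located         : ∀ q r → q ℚ.< r → Lower q ⊎ Upper r

open ℝ public using (Lower; Upper)

fromℕ : ℕ → ℚ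
fromℕ n = + n ℚ./ 1

Positive : ℝ → Set
Positive x = Lower x 0ℚ

infix 4 _·_⊑_ _⊑_·_

-- x · n ⊑ a  is  x n ≤ a, and  a ⊑ k · x  is  a ≤ k x, in the reals.

_·_⊑_ : ℝ → ℕ → ℕ → Set
x · n ⊑ a = ∀ r → Lower x r → r ℚ.* fromℕ n ℚ.≤ fromℕ a

_⊑_·_ : ℕ → ℕ → ℝ → Set
a ⊑ k · x = ∀ r → Upper x r → fromℕ a ℚ.≤ fromℕ k ℚ.* r

-- ℓ = ⌈log₂ (a / x)⌉ for real x with 0 < x ≤ a. The ceiling of a real y is the
-- least integer k with y ≤ k, and log₂ (a / x) ≤ k means a ≤ 2ᵏ x. As a / x ≥ 1,
-- the least integer is a natural number. The ceiling is not computable from a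
-- Dedekind cut, hence a relation rather than a function.

_≡⌈log₂_/_⌉ : ℕ → ℕ → ℝ → Set
ℓ ≡⌈log₂ a / x ⌉ = a ⊑ 2 ^ ℓ · x × (∀ k → a ⊑ 2 ^ k · x → ℓ ≤ k)

-- d ≤ k log₂ x, exponentiated.

infix 4 _≼_·log₂_

_≼_·log₂_ : ℕ → ℕ → ℕ → Set
d ≼ k ·log₂ x = 2 ^ d ≤ x ^ k

⌈_/_⌉ : (a b : ℕ) .{{_ : NonZero b}} → ℕ
⌈ a / b ⌉ = (a + (b ∸ 1)) / b

h[_,_,_] : (p q : ℕ) → 2 * p < q → ℕ
h[ p , q , 2p<q ] = ⌈ 2 * q / q ∸ 2 * p ⌉
  where instance _ = >-nonZero (m<n⇒0<n∸m 2p<q)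

module _ {n : ℕ} where

  greater smaller : Fin n → Subset n
  greater x = tabulate (λ y → does (x Fin.<? y))
  smaller x = tabulate (λ y → does (y Fin.<? x))

  AmongTop AmongBottom : ℕ → Subset n → Fin n → Set
  AmongTop    i S x = x ∈ S × ∣ S ∩ greater x ∣ < i
  AmongBottom j S x = x ∈ S × ∣ S ∩ smaller x ∣ < j

  Mediocre : ℕ → ℕ → Subset n → Fin n → Set
  Mediocre i j S x = x ∈ S × ¬ AmongTop i S x × ¬ AmongBottom j S x

-- Deterministic two-party protocols as trees. A node is a transcript so far and
-- its constructor says who sends the next bit; at a leaf each player computes an
-- optional output from their own input.

data Protocol (X Y Z : Set) : Set where
  output : (X → Maybe Z) → (Y → Maybe Z) → Protocol X Y Z
  alice  : (X → Bool) → (Bool → Protocol X Y Z) → Protocol X Y Z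
  bob    : (Y → Bool) → (Bool → Protocol X Y Z) → Protocol X Y Z

module _ {X Y Z : Set} where

  run : Protocol X Y Z → X → Y → Maybe Z × Maybe Z
  run (output f g) x y = f x , g y
  run (alice m k)  x y = run (k (m x)) x y
  run (bob m k)    x y = run (k (m y)) x y

  bits : Protocol X Y Z → X → Y → ℕ
  bits (output _ _) x y = 0
  bits (alice m k)  x y = suc (bits (k (m x)) x y)
  bits (bob m k)    x y = suc (bits (k (m y)) x y)

  -- The maximum of bits over the inputs satisfying Adm is at most d.
  ComplexityAtMost : (X → Y → Set) → Protocol X Y Z → ℕ → Set
  ComplexityAtMost Adm Π d = ∀ x y → Adm x y → bits Π x y ≤ d

FoundByAtLeastOne : {Z : Set} → (Z → Set) → Maybe Z × Maybe Z → Set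
FoundByAtLeastOne P (a , b) = (Is-just a ⊎ Is-just b) × All P a × All P b

record Admissible {n : ℕ} (t : ℕ) (A B : Subset n) : Set where
  field
    disjoint : Empty (A ∩ B)
    ordered  : ∣ A ∣ ≤ ∣ B ∣
    total    : ∣ A ∣ + ∣ B ∣ ≡ t

-- The set [n] is represented by the order-isomorphic Fin n.

FindsMediocre : {n : ℕ} (t i j : ℕ) →
                Protocol (Subset n) (Subset n) (Fin n) → Set
FindsMediocre t i j Π = ∀ A B → Admissible t A B →
  FoundByAtLeastOne (Mediocre i j (A ∪ B)) (run Π A B)

{-# OPTIONS --safe #-}

-- Cut [n] into 2^ℓ nearly equal cells. As 12 h n ≤ 2^ℓ t, a cell holds at most
-- t/12h + 1 elements of A ∪ B. To test a cut, Alice sends the number of her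
-- elements below it in units of t/2h, rounded down; Bob adds his own rounded
-- number and answers whether the sum reaches h. Binary search over the cuts
-- finds a cell at which the sum passes from below h to at least h. One of the
-- players has an element in this cell, since a rounded number changes there. The
-- rounding lets the ranks at its two ends miss t/2 by at most t/2h and the size of
-- the cell adds t/12h, so all its elements stay within the slack t/2 − αt ≥ t/h.
-- Each of the ℓ rounds costs log h + O(1) bits.

module Submission where

open import Defs
open import Data.Bool.Base using (T; true; false; if_then_else_)
open import Data.Fin.Base using (Fin; zero; suc; toℕ)
import Data.Fin.Properties as Fin
open import Data.Fin.Subset using (Subset; inside; outside; _∈_; _∩_; _∪_; ∣_∣; Empty)
open import Data.Fin.Subset.Properties using (drop-∷-Empty; _∈?_; x∈p∪q⁺)
open import Data.Integer.Base as ℤ using (-[1+_]; +[1+_]; +<+; +≤+)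
import Data.Integer.Properties as ℤ
open import Data.Maybe using (Maybe; Is-just)
import Data.Maybe as Maybe
import Data.Maybe.Relation.Unary.All as MaybeAll
import Data.Maybe.Relation.Unary.Any as MaybeAny
open import Data.Nat.Base using
  ( ℕ; zero; suc; NonZero; >-nonZero; >-nonZero⁻¹; _+_; _*_; _∸_; _^_; _/_; _%_
  ; _≤_; _<_; _≤ᵇ_; z≤n; s≤s; z<s; s<s; s≤s⁻¹; s<s⁻¹)
open import Data.Nat.Coprimality using (1-coprimeTo) renaming (sym to coprime-sym)
open import Data.Nat.DivMod
  using (m≡m%n+[m/n]*n; m%n<n; m/n*n≤m; m*n/n≡m; /-monoˡ-≤; m<n*o⇒m/o<n; 0/n≡0)
open import Data.Nat.Properties
open import Data.Nat.Tactic.RingSolver using (solve-∀)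
open import Data.Product.Base using (_×_; _,_; ∃; ∃-syntax; Σ-syntax; proj₁; proj₂)
open import Data.Rational.Base as ℚ using (ℚ; mkℚ; 0ℚ)
import Data.Rational.Properties as ℚ
import Data.Rational.Unnormalised.Base as ℚᵘ
import Data.Rational.Unnormalised.Properties as ℚᵘ
open import Data.Sum.Base as Sum using (_⊎_; inj₁; inj₂)
open import Data.Unit.Base using (tt)
open import Data.Vec.Base using ([]; _∷_; here; there; tabulate)
open import Function.Base using (_∘_)
open import Function.Bundles using (Equivalence)
open import Relation.Binary.PropositionalEquality
  using (_≡_; refl; sym; trans; cong; cong₂; subst; subst₂; module ≡-Reasoning)
open import Relation.Nullary using (¬_; Dec; yes; no; contradiction)
open import Relation.Nullary.Decidable using (_×-dec_; dec⇒maybe)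

private variable n : ℕ

-- Ranks of cuts in a subset of `Fin n`.

-- The argument is a cut rather than an element, hence a natural number: the cut at `n`, above all
-- elements, is allowed.
rank : Subset n → ℕ → ℕ
rank []            _       = 0
rank (_ ∷ _)       zero    = 0
rank (inside ∷ S)  (suc x) = suc (rank S x)
rank (outside ∷ S) (suc x) = rank S x

rank-zero : (S : Subset n) → rank S 0 ≡ 0
rank-zero []      = refl
rank-zero (_ ∷ _) = refl

rank-full : (S : Subset n) → rank S n ≡ ∣ S ∣
rank-full []            = refl
rank-full (inside ∷ S)  = cong suc (rank-full S)
rank-full (outside ∷ S) = rank-full S

rank≤∣S∣ : (S : Subset n) (x : ℕ) → rank S x ≤ ∣ S ∣
rank≤∣S∣ []            x       = z≤n
rank≤∣S∣ (_ ∷ _)       zero    = z≤n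
rank≤∣S∣ (inside ∷ S)  (suc x) = s≤s (rank≤∣S∣ S x)
rank≤∣S∣ (outside ∷ S) (suc x) = rank≤∣S∣ S x

rank-∪ : (A B : Subset n) → Empty (A ∩ B) → ∀ x → rank (A ∪ B) x ≡ rank A x + rank B x
rank-∪ []            []            _   x       = refl
rank-∪ (_ ∷ _)       (_ ∷ _)       _   zero    = refl
rank-∪ (inside ∷ A)  (inside ∷ B)  A∩B (suc x) = contradiction (zero , here) A∩B
rank-∪ (inside ∷ A)  (outside ∷ B) A∩B (suc x) = cong suc (rank-∪ A B (drop-∷-Empty A∩B) x)
rank-∪ (outside ∷ A) (inside ∷ B)  A∩B (suc x) =
  trans (cong suc (rank-∪ A B (drop-∷-Empty A∩B) x)) (sym (+-suc _ _))
rank-∪ (outside ∷ A) (outside ∷ B) A∩B (suc x) = rank-∪ A B (drop-∷-Empty A∩B) x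

-- Each position holds at most one element. This turns the width of a cell into a bound on ranks.
rank-+ : (S : Subset n) (x d : ℕ) → rank S (x + d) ≤ rank S x + d
rank-+ []            x       d       = z≤n
rank-+ (s ∷ S)       zero    zero    = z≤n
rank-+ (inside ∷ S)  zero    (suc d) = s≤s (subst (λ r → rank S d ≤ r + d) (rank-zero S) (rank-+ S 0 d))
rank-+ (outside ∷ S) zero    (suc d) = m≤n⇒m≤1+n (subst (λ r → rank S d ≤ r + d) (rank-zero S) (rank-+ S 0 d))
rank-+ (inside ∷ S)  (suc x) d       = s≤s (rank-+ S x d)
rank-+ (outside ∷ S) (suc x) d       = rank-+ S x d

rank-lipschitz : (S : Subset n) {x y : ℕ} → x ≤ y → rank S y ≤ rank S x + (y ∸ x)
rank-lipschitz S {x} {y} x≤y =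
  subst (λ z → rank S z ≤ rank S x + (y ∸ x)) (m+[n∸m]≡n x≤y) (rank-+ S x (y ∸ x))

∣S∩smaller∣ : (S : Subset n) (e : Fin n) → ∣ S ∩ smaller e ∣ ≡ rank S (toℕ e)
∣S∩smaller∣ (inside ∷ S)  zero    = none S
  where
  none : (S : Subset n) → ∣ S ∩ tabulate (λ _ → false) ∣ ≡ 0
  none []            = refl
  none (inside ∷ S)  = none S
  none (outside ∷ S) = none S
-- The head is not below itself, so its membership in the set does not affect either side.
∣S∩smaller∣ (outside ∷ S) zero    = ∣S∩smaller∣ (inside ∷ S) zero
∣S∩smaller∣ (inside ∷ S)  (suc e) = cong suc (∣S∩smaller∣ S e)
∣S∩smaller∣ (outside ∷ S) (suc e) = ∣S∩smaller∣ S e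

∣S∩greater∣ : (S : Subset n) (e : Fin n) → ∣ S ∩ greater e ∣ + rank S (suc (toℕ e)) ≡ ∣ S ∣
∣S∩greater∣ (inside ∷ S)  zero    =
  trans (+-suc _ _) (cong suc (trans (cong₂ _+_ (all S) (rank-zero S)) (+-identityʳ ∣ S ∣)))
  where
  all : (S : Subset n) → ∣ S ∩ tabulate (λ _ → true) ∣ ≡ ∣ S ∣
  all []            = refl
  all (inside ∷ S)  = cong suc (all S)
  all (outside ∷ S) = all S
∣S∩greater∣ (outside ∷ S) zero    = suc-injective (trans (sym (+-suc _ _)) (∣S∩greater∣ (inside ∷ S) zero))
∣S∩greater∣ (inside ∷ S)  (suc e) = trans (+-suc _ _) (cong suc (∣S∩greater∣ S e))
∣S∩greater∣ (outside ∷ S) (suc e) = ∣S∩greater∣ S e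

-- The source of the returned element: a player whose rank grows across a cell owns an element in
-- it.
rank-<⇒∃∈ : (S : Subset n) {x y : ℕ} → rank S x < rank S y → ∃[ e ] (e ∈ S × x ≤ toℕ e × toℕ e < y)
rank-<⇒∃∈ (inside ∷ S)  {zero}  {suc y} _ = zero , here , z≤n , z<s
rank-<⇒∃∈ (outside ∷ S) {zero}  {suc y} r =
  let e , e∈S , _ , e<y = rank-<⇒∃∈ S (subst (_< rank S y) (sym (rank-zero S)) r)
  in suc e , there e∈S , z≤n , s<s e<y
rank-<⇒∃∈ (inside ∷ S)  {suc x} {suc y} r =
  let e , e∈S , x≤e , e<y = rank-<⇒∃∈ S (s<s⁻¹ r) in suc e , there e∈S , s≤s x≤e , s<s e<y
rank-<⇒∃∈ (outside ∷ S) {suc x} {suc y} r =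
  let e , e∈S , x≤e , e<y = rank-<⇒∃∈ S r in suc e , there e∈S , s≤s x≤e , s<s e<y

-- Choosing an element of a cell.

Between : ℕ → ℕ → Subset n → Fin n → Set
Between x y S e = e ∈ S × x ≤ toℕ e × toℕ e < y

between? : (x y : ℕ) (S : Subset n) → Dec (∃ (Between x y S))
between? x y S = Fin.any? λ e → (e ∈? S) ×-dec ((x ≤? toℕ e) ×-dec (toℕ e <? y))

-- A player's output rule. It uses the player's own set and the cell, which the transcript
-- determines.
pick : (x y : ℕ) → Subset n → Maybe (Fin n)
pick x y S = Maybe.map proj₁ (dec⇒maybe (between? x y S))

pick-just : {x y : ℕ} (S : Subset n) → ∃ (Between x y S) → Is-just (pick x y S)
pick-just {x = x} {y} S w with between? x y S
... | yes _ = MaybeAny.just tt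
... | no ¬w = contradiction w ¬w

pick-between : (x y : ℕ) (S : Subset n) → MaybeAll.All (Between x y S) (pick x y S)
pick-between x y S with between? x y S
... | yes (_ , e) = MaybeAll.just e
... | no _        = MaybeAll.nothing

-- Sending numbers and binary search as protocols.

module _ {X Y Z : Set} where

  -- A binary code of fixed length, leading bit first. The value sent so far is stored in the
  -- continuation by precomposition with `2 ^ k +_`.
  send : ℕ → (X → ℕ) → (ℕ → Protocol X Y Z) → Protocol X Y Z
  send zero    f Π = Π 0
  send (suc k) f Π = alice (λ x → 2 ^ k ≤ᵇ f x) λ β →
    if β then send k (λ x → f x ∸ 2 ^ k) (Π ∘ (2 ^ k +_)) else send k f Π

  -- Stripping the leading bit of a number below `2 ^ suc k` leaves one below `2 ^ k`; after the
  -- last bit only 0 remains, the value the empty message stands for.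
  send-correct : ∀ k f Π {x y} → f x < 2 ^ k →
    run (send k f Π) x y ≡ run (Π (f x)) x y × bits (send k f Π) x y ≡ k + bits (Π (f x)) x y
  send-correct zero f Π {x} fx<1 with f x
  ... | zero = refl , refl
  ... | suc _ = contradiction fx<1 λ { (s≤s ()) }
  send-correct (suc k) f Π {x} {y} fx< with 2 ^ k ≤ᵇ f x in eq
  ... | true  =
    let 2ᵏ≤fx = ≤ᵇ⇒≤ (2 ^ k) (f x) (subst T (sym eq) tt)
        split = m+[n∸m]≡n 2ᵏ≤fx
        r , b = send-correct k (λ x → f x ∸ 2 ^ k) (Π ∘ (2 ^ k +_)) {x} {y}
                  (+-cancelˡ-< (2 ^ k) _ _ (subst₂ _<_ (sym split) (cong (2 ^ k +_) (+-identityʳ (2 ^ k))) fx<))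
    in trans r (cong (λ v → run (Π v) x y) split)
     , cong suc (trans b (cong (λ v → k + bits (Π v) x y) split))
  ... | false =
    let r , b = send-correct k f Π {x} {y} (≰⇒> λ le → subst T eq (≤⇒≤ᵇ le))
    in r , cong suc b

  module Search (k h : ℕ) (a : ℕ → X → ℕ) (b : ℕ → Y → ℕ) (leaf : ℕ → Protocol X Y Z) where

    mutual
      search : ℕ → ℕ → Protocol X Y Z
      search zero    i = leaf i
      search (suc j) i = send k (a (i + 2 ^ j)) (compare j i)

      -- `v` is the number received from Alice. Bob's answer puts both players in the same half of
      -- the interval of `2 ^ suc j` cells starting at `i`.
      compare : ℕ → ℕ → ℕ → Protocol X Y Z
      compare j i v = bob (λ y → h ≤ᵇ v + b (i + 2 ^ j) y) λ β →
        search j (if β then i else i + 2 ^ j)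

    -- The invariant of the search. Wherever the sum at the midpoint lies, one of the halves has it
    -- again, so it survives down to a single cell.
    Crosses : X → Y → ℕ → ℕ → Set
    Crosses x y i i′ = a i x + b i y < h × h ≤ a i′ x + b i′ y

    -- A round consists of `k` bits from Alice and one from Bob.
    add-round : ∀ j {u v} → u ≡ j * suc k + v → k + suc u ≡ suc j * suc k + v
    add-round j {v = v} refl = trans (+-suc k _) (sym (+-assoc (suc k) (j * suc k) v))

    search-correct : ∀ {x y} → (∀ i → a i x < 2 ^ k) → ∀ j i → Crosses x y i (i + 2 ^ j) →
      ∃[ i′ ] (Crosses x y i′ (suc i′) × run (search j i) x y ≡ run (leaf i′) x y
               × bits (search j i) x y ≡ j * suc k + bits (leaf i′) x y)
    search-correct a< zero i c = i , subst (Crosses _ _ i) (+-comm i 1) c , refl , refl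
    search-correct {x} {y} a< (suc j) i (lo , hi)
      rewrite proj₁ (send-correct k (a (i + 2 ^ j)) (compare j i) {x} {y} (a< _))
            | proj₂ (send-correct k (a (i + 2 ^ j)) (compare j i) {x} {y} (a< _))
      with h ≤ᵇ a (i + 2 ^ j) x + b (i + 2 ^ j) y in eq
    ... | true  =
      let i′ , c , r , l = search-correct a< j i (lo , ≤ᵇ⇒≤ _ _ (subst T (sym eq) tt))
      in i′ , c , r , add-round j l
    ... | false =
      let i′ , c , r , l = search-correct a< j (i + 2 ^ j)
                             ( ≰⇒> (λ le → subst T eq (≤⇒≤ᵇ le))
                             , subst (λ u → h ≤ a u x + b u y) halves hi )
      in i′ , c , r , add-round j l
      where
      halves : i + 2 ^ suc j ≡ i + 2 ^ j + 2 ^ j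
      halves = trans (cong (λ u → i + (2 ^ j + u)) (+-identityʳ (2 ^ j))) (sym (+-assoc i (2 ^ j) (2 ^ j)))

-- Integer arithmetic: rounding, the constant `h`, powers of two and the slack.

m<1+m/n*n : ∀ m n .{{_ : NonZero n}} → m < suc (m / n) * n
m<1+m/n*n m n = begin-strict
  m                    ≡⟨ m≡m%n+[m/n]*n m n ⟩
  m % n + (m / n) * n  <⟨ +-monoˡ-< _ (m%n<n m n) ⟩
  n + (m / n) * n      ∎
  where open ≤-Reasoning

a≤⌈a/b⌉*b : ∀ a b .{{_ : NonZero b}} → a ≤ ⌈ a / b ⌉ * b
a≤⌈a/b⌉*b a b@(suc b-1) = +-cancelˡ-≤ b _ _ (begin
  b + a              ≡⟨ +-comm b a ⟩
  a + suc b-1        ≡⟨ +-suc a b-1 ⟩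
  suc (a + b-1)      ≤⟨ m<1+m/n*n (a + b-1) b ⟩
  b + ⌈ a / b ⌉ * b  ∎)
  where open ≤-Reasoning

⌈a/b⌉≤a : ∀ a b .{{_ : NonZero b}} → ⌈ a / b ⌉ ≤ a
⌈a/b⌉≤a a b@(suc b-1) = s≤s⁻¹ (m<n*o⇒m/o<n (begin-strict
  a + b-1      ≤⟨ +-monoˡ-≤ b-1 (m≤m*n a b) ⟩
  a * b + b-1  <⟨ +-monoʳ-< (a * b) (n<1+n b-1) ⟩
  a * b + b    ≡⟨ +-comm (a * b) b ⟩
  suc a * b    ∎))
  where open ≤-Reasoning

module _ {p q : ℕ} (0<p : 0 < p) (2p<q : 2 * p < q) where

  private
    h = h[ p , q , 2p<q ]
    instance _ = >-nonZero (m<n⇒0<n∸m 2p<q)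

  -- The denominator `q ∸ 2 * p` is at least 1. This makes the final constant independent of `p`.
  h≤2q : h ≤ 2 * q
  h≤2q = ⌈a/b⌉≤a (2 * q) (q ∸ 2 * p)

  -- Divided by 2hq this is 1/h ≤ 1/2 - p/q, the slack around the median.
  2q+2ph≤hq : 2 * q + 2 * p * h ≤ h * q
  2q+2ph≤hq = begin
    2 * q + 2 * p * h                ≤⟨ +-monoˡ-≤ _ (a≤⌈a/b⌉*b (2 * q) (q ∸ 2 * p)) ⟩
    h * (q ∸ 2 * p) + 2 * p * h      ≡⟨ cong (h * (q ∸ 2 * p) +_) (*-comm (2 * p) h) ⟩
    h * (q ∸ 2 * p) + h * (2 * p)    ≡⟨ *-distribˡ-+ h _ _ ⟨
    h * (q ∸ 2 * p + 2 * p)          ≡⟨ cong (h *_) (m∸n+n≡m (<⇒≤ 2p<q)) ⟩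
    h * q                            ∎
    where open ≤-Reasoning

  2≤h : 2 ≤ h
  2≤h = *-cancelʳ-≤ 2 h q (≤-trans (m≤m+n (2 * q) _) 2q+2ph≤hq)
    where instance _ = >-nonZero (≤-<-trans z≤n 2p<q)

  -- Positivity of `p` makes 2q < hq strict.
  3≤h : 3 ≤ h
  3≤h = *-cancelʳ-< q 2 h (begin-strict
    2 * q              <⟨ m<m+n (2 * q) (*-mono-≤ {1} {2 * p} (*-mono-≤ {1} {2} (s≤s z≤n) 0<p) (<⇒≤ 2≤h)) ⟩
    2 * q + 2 * p * h  ≤⟨ 2q+2ph≤hq ⟩
    h * q              ∎)
    where open ≤-Reasoning

-- Applied to the heights at the two ends of a cell: if their sum grows, the height of one of the
-- players grows.
m+n<o+p⇒m<o∨n<p : ∀ {m n o p} → m + n < o + p → m < o ⊎ n < p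
m+n<o+p⇒m<o∨n<p {m} {n} {o} {p} lt with m <? o
... | yes m<o = inj₁ m<o
... | no  m≮o = inj₂ (+-cancelˡ-< o n p (≤-<-trans (+-monoˡ-≤ n (≮⇒≥ m≮o)) lt))

power-of-two : ∀ m .{{_ : NonZero m}} → ∃[ k ] (m < 2 ^ k × 2 ^ k ≤ 2 * m)
power-of-two (suc zero)        = 1 , ≤-refl , ≤-refl
power-of-two (suc m@(suc _)) with k , m<2ᵏ , 2ᵏ≤2m ← power-of-two m | suc m <? 2 ^ k
... | yes 1+m<2ᵏ = k , 1+m<2ᵏ , ≤-trans 2ᵏ≤2m (*-monoʳ-≤ 2 (n≤1+n m))
-- Here `2 ^ k` equals `suc m`, so doubling it exceeds `suc m` and meets the upper bound.
... | no  1+m≮2ᵏ = suc k , ≤-<-trans m<2ᵏ (m<m+n (2 ^ k) (≤-trans (m^n>0 2 k) (m≤m+n _ 0)))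
                 , *-monoʳ-≤ 2 (≮⇒≥ 1+m≮2ᵏ)

-- If at least t/2 − t/2h elements lie on one side of a cut at distance less than
-- n/N + 1 from an element, then at least pt/q lie on that side of the element.
slack : ∀ {p q h N n t δ X Y r} .{{_ : NonZero q}} .{{_ : NonZero h}} →
  2 * q + 2 * p * h ≤ h * q → 12 * h * n ≤ N * t → N * δ < N + n →
  r * q ≤ p * t → t * h ≤ 2 * h * X + t → X ≤ Y + δ → r ≤ Y
slack {p} {q} {h} {N} {n} {t} {δ} {X} {Y} {r} hq 12hn≤Nt Nδ<N+n rq≤pt th≤ X≤Y+δ =
  ≮⇒≥ λ Y<r → <-irrefl refl (begin-strict
    -- The term `12 * N * q * h` raises `X` to `suc X`, which uses the strictness of `Y < r`. It
    -- comes back at the end as the share of `N` in the bound `N + n`.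
    6 * N * q * (t * h) + 12 * N * q * h
      ≤⟨ +-monoˡ-≤ _ (*-monoʳ-≤ (6 * N * q) th≤) ⟩
    6 * N * q * (2 * h * X + t) + 12 * N * q * h
      ≡⟨ collect-X N q h X t ⟩
    12 * N * q * h * suc X + 6 * N * q * t
      ≤⟨ +-monoˡ-≤ _ (*-monoʳ-≤ (12 * N * q * h) (≤-trans (s≤s X≤Y+δ) (+-monoˡ-≤ δ Y<r))) ⟩
    12 * N * q * h * (r + δ) + 6 * N * q * t
      ≡⟨ split-r+δ N q h r δ t ⟩
    12 * N * h * (r * q) + 6 * N * q * t + 12 * q * h * (N * δ)
      <⟨ +-mono-≤-< (+-monoˡ-≤ _ (*-monoʳ-≤ (12 * N * h) rq≤pt)) (*-monoʳ-< (12 * q * h) Nδ<N+n) ⟩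
    12 * N * h * (p * t) + 6 * N * q * t + 12 * q * h * (N + n)
      ≡⟨ split-N+n N h p t q n ⟩
    12 * N * h * (p * t) + 6 * N * q * t + 12 * N * q * h + q * (12 * h * n)
      -- The cell size costs `q * (N * t)`; the other summand fills this up to 6Nqt, the half of the
      -- slack that rounding leaves.
      ≤⟨ +-monoʳ-≤ _ (≤-trans (*-monoʳ-≤ q 12hn≤Nt) (m≤m+n _ (5 * q * N * t))) ⟩
    12 * N * h * (p * t) + 6 * N * q * t + 12 * N * q * h + (q * (N * t) + 5 * q * N * t)
      ≡⟨ collect-t N h p t q ⟩
    6 * N * t * (2 * q + 2 * p * h) + 12 * N * q * h
      ≤⟨ +-monoˡ-≤ _ (*-monoʳ-≤ (6 * N * t) hq) ⟩
    6 * N * t * (h * q) + 12 * N * q * h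
      ≡⟨ cong (_+ 12 * N * q * h) (swap-tq N t h q) ⟩
    6 * N * q * (t * h) + 12 * N * q * h ∎)
  where
  open ≤-Reasoning
  instance _ = m*n≢0 (12 * q) h {{m*n≢0 12 q}}
  collect-X : ∀ N q h X t → 6 * N * q * (2 * h * X + t) + 12 * N * q * h ≡
                            12 * N * q * h * suc X + 6 * N * q * t
  collect-X = solve-∀
  split-r+δ : ∀ N q h r δ t → 12 * N * q * h * (r + δ) + 6 * N * q * t ≡
                              12 * N * h * (r * q) + 6 * N * q * t + 12 * q * h * (N * δ)
  split-r+δ = solve-∀
  split-N+n : ∀ N h p t q n →
    12 * N * h * (p * t) + 6 * N * q * t + 12 * q * h * (N + n) ≡
    12 * N * h * (p * t) + 6 * N * q * t + 12 * N * q * h + q * (12 * h * n)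
  split-N+n = solve-∀
  collect-t : ∀ N h p t q →
    12 * N * h * (p * t) + 6 * N * q * t + 12 * N * q * h + (q * (N * t) + 5 * q * N * t) ≡
    6 * N * t * (2 * q + 2 * p * h) + 12 * N * q * h
  collect-t = solve-∀
  swap-tq : ∀ N t h q → 6 * N * t * (h * q) ≡ 6 * N * q * (t * h)
  swap-tq = solve-∀

-- Rationals and Dedekind cuts.

-- Division in ℚ normalises by a gcd, which is stuck on a variable; the explicit fraction lets
-- products and comparisons compute.
fromℕ-mkℚ : ∀ n → fromℕ n ≡ mkℚ (ℤ.+ n) 0 (coprime-sym (1-coprimeTo n))
fromℕ-mkℚ n = ℚ.normalize-coprime (coprime-sym (1-coprimeTo n))

fromℕ-* : ∀ m n → fromℕ (m * n) ≡ fromℕ m ℚ.* fromℕ n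
fromℕ-* m n rewrite fromℕ-mkℚ m | fromℕ-mkℚ n = cong (ℚ._/ 1) (ℤ.pos-* m n)

fromℕ-mono-≤ : ∀ {m n} → m ≤ n → fromℕ m ℚ.≤ fromℕ n
fromℕ-mono-≤ {m} {n} m≤n rewrite fromℕ-mkℚ m | fromℕ-mkℚ n =
  ℚ.*≤* (ℤ.*-monoʳ-≤-nonNeg (ℤ.+ 1) (+≤+ m≤n))

fromℕ-mono-< : ∀ {m n} → m < n → fromℕ m ℚ.< fromℕ n
fromℕ-mono-< {m} {n} m<n rewrite fromℕ-mkℚ m | fromℕ-mkℚ n =
  ℚ.*<* (ℤ.*-monoʳ-<-pos (ℤ.+ 1) (+<+ m<n))

fromℕ-pos : ∀ n .{{_ : NonZero n}} → ℚ.Positive (fromℕ n)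
fromℕ-pos n = ℚ.positive (fromℕ-mono-< (>-nonZero⁻¹ n))

fromℕ-nonNeg : ∀ n → ℚ.NonNegative (fromℕ n)
fromℕ-nonNeg n = ℚ.nonNegative {fromℕ n} (fromℕ-mono-≤ {0} {n} z≤n)

-- Locatedness of x is applied to the rationals b / n < a / k.
⊑-cross : ∀ x {a b} k n .{{_ : NonZero k}} .{{_ : NonZero n}} →
  a ⊑ k · x → x · n ⊑ b → a * n ≤ k * b
⊑-cross x {a} {b} k n a⊑kx xn⊑b = ≮⇒≥ λ kb<an → impossible (ℝ.located x u v (u<v kb<an))
  where
  instance
    _ = fromℕ-pos k
    _ = fromℕ-pos n
    _ = ℚ.pos⇒nonZero (fromℕ k)
    _ = ℚ.pos⇒nonZero (fromℕ n)
    _ = fromℕ-nonNeg k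
    _ = fromℕ-nonNeg n
  u v : ℚ
  u = fromℕ b ℚ.÷ fromℕ n
  v = ℚ.1/ fromℕ k ℚ.* fromℕ a

  un≡b : u ℚ.* fromℕ n ≡ fromℕ b
  un≡b = trans (ℚ.*-assoc (fromℕ b) _ _)
        (trans (cong (fromℕ b ℚ.*_) (ℚ.*-inverseˡ (fromℕ n))) (ℚ.*-identityʳ _))

  kv≡a : fromℕ k ℚ.* v ≡ fromℕ a
  kv≡a = trans (sym (ℚ.*-assoc (fromℕ k) _ _))
        (trans (cong (ℚ._* fromℕ a) (ℚ.*-inverseʳ (fromℕ k))) (ℚ.*-identityˡ _))

  u<v : k * b < a * n → u ℚ.< v
  u<v kb<an = ℚ.*-cancelˡ-<-nonNeg (fromℕ k) (ℚ.*-cancelʳ-<-nonNeg (fromℕ n) (begin-strict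
    fromℕ k ℚ.* u ℚ.* fromℕ n    ≡⟨ ℚ.*-assoc (fromℕ k) u _ ⟩
    fromℕ k ℚ.* (u ℚ.* fromℕ n)  ≡⟨ cong (fromℕ k ℚ.*_) un≡b ⟩
    fromℕ k ℚ.* fromℕ b          ≡⟨ fromℕ-* k b ⟨
    fromℕ (k * b)                <⟨ fromℕ-mono-< kb<an ⟩
    fromℕ (a * n)                ≡⟨ fromℕ-* a n ⟩
    fromℕ a ℚ.* fromℕ n          ≡⟨ cong (ℚ._* fromℕ n) kv≡a ⟨
    fromℕ k ℚ.* v ℚ.* fromℕ n    ∎))
    where open ℚ.≤-Reasoning

  impossible : ¬ (Lower x u ⊎ Upper x v)
  -- The cuts are open: some `r` in the lower cut lies strictly above `u`, contradicting the weak
  -- bound `xn⊑b`. The other case is dual.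
  impossible (inj₁ lo) with r , u<r , lo′ ← Equivalence.to (ℝ.lower-rounded x u) lo =
    ℚ.<-irrefl un≡b (ℚ.<-≤-trans (ℚ.*-monoˡ-<-pos (fromℕ n) u<r) (xn⊑b r lo′))
  impossible (inj₂ up) with r , r<v , up′ ← Equivalence.to (ℝ.upper-rounded x v) up =
    ℚ.<-irrefl (sym kv≡a) (ℚ.≤-<-trans (a⊑kx r up′) (ℚ.*-monoʳ-<-pos (fromℕ k) r<v))

lower≤upper : ∀ x {r s} → Lower x r → Upper x s → r ℚ.≤ s
lower≤upper x {r} {s} lo up = ℚ.≮⇒≥ λ s<r →
  ℝ.disjoint x r (lo , Equivalence.from (ℝ.upper-rounded x r) (s , s<r , up))

n<2^n : ∀ n → n < 2 ^ n
n<2^n zero    = z<s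
n<2^n (suc n) = subst (suc n <_) (cong (2 ^ n +_) (sym (+-identityʳ (2 ^ n))))
  (+-mono-≤-< (m^n>0 2 n) (n<2^n n))

-- The product is the numerator, a positive integer. This is the Archimedean property with an
-- explicit multiplier.
1≤↧r*r : ∀ r → 0ℚ ℚ.< r → fromℕ 1 ℚ.≤ fromℕ (ℚ.↧ₙ r) ℚ.* r
1≤↧r*r r@(mkℚ +[1+ m ] d _) _ rewrite fromℕ-mkℚ (suc d) =
  ℚ.toℚᵘ-cancel-≤ (ℚᵘ.≤-respʳ-≃
    (ℚᵘ.≃-sym (ℚ.toℚᵘ-homo-* (mkℚ (ℤ.+ suc d) 0 (coprime-sym (1-coprimeTo (suc d)))) r))
    (ℚᵘ.*≤* (+≤+ (begin
      1 * (1 * suc d)    ≡⟨ trans (*-identityˡ _) (*-identityˡ _) ⟩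
      suc d              ≤⟨ m≤m*n (suc d) (suc m) ⟩
      suc d * suc m      ≡⟨ *-identityʳ _ ⟨
      suc d * suc m * 1  ∎))))
  where open ≤-Reasoning
1≤↧r*r (mkℚ (ℤ.+ 0)    _ _) (ℚ.*<* (+<+ ()))
1≤↧r*r (mkℚ -[1+ _ ] _ _) (ℚ.*<* ())

-- A rational `r` with 0 < r < x gives a ≤ L r ≤ 2^L r for `L` equal to `a` times the denominator of
-- `r`. By minimality such an `L` bounds the ceiling of the logarithm.
⊑-2^ : ∀ x → Positive x → ∀ a → ∃[ L ] (a ⊑ 2 ^ L · x)
⊑-2^ x 0<x a with r , 0<r , lo ← Equivalence.to (ℝ.lower-rounded x 0ℚ) 0<x = a * ℚ.↧ₙ r , λ s up →
  let L = a * ℚ.↧ₙ r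
      instance
        _ = fromℕ-nonNeg a
        _ = ℚ.nonNegative (ℚ.<⇒≤ 0<r)
        _ = fromℕ-nonNeg (2 ^ L)
  in begin
    fromℕ a                              ≡⟨ ℚ.*-identityʳ (fromℕ a) ⟨
    fromℕ a ℚ.* fromℕ 1                  ≤⟨ ℚ.*-monoˡ-≤-nonNeg (fromℕ a) (1≤↧r*r r 0<r) ⟩
    fromℕ a ℚ.* (fromℕ (ℚ.↧ₙ r) ℚ.* r)   ≡⟨ ℚ.*-assoc (fromℕ a) _ r ⟨
    fromℕ a ℚ.* fromℕ (ℚ.↧ₙ r) ℚ.* r     ≡⟨ cong (ℚ._* r) (fromℕ-* a _) ⟨
    fromℕ L ℚ.* r                        ≤⟨ ℚ.*-monoʳ-≤-nonNeg r (fromℕ-mono-≤ (<⇒≤ (n<2^n L))) ⟩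
    fromℕ (2 ^ L) ℚ.* r                  ≤⟨ ℚ.*-monoˡ-≤-nonNeg (fromℕ (2 ^ L)) (lower≤upper x lo up) ⟩
    fromℕ (2 ^ L) ℚ.* s                  ∎
  where open ℚ.≤-Reasoning

-- The protocol and its correctness.

mediocre : ∀ {n i j} {S : Subset n} {e} → e ∈ S →
  i ≤ ∣ S ∩ greater e ∣ → j ≤ ∣ S ∩ smaller e ∣ → Mediocre i j S e
mediocre e∈S i≤ j≤ = e∈S , (λ (_ , <i) → <⇒≱ <i i≤) , (λ (_ , <j) → <⇒≱ <j j≤)

module MedianProtocol (p q h ℓ k n t : ℕ) .{{_ : NonZero q}} .{{_ : NonZero h}} .{{_ : NonZero t}}
  (2q+2ph≤hq : 2 * q + 2 * p * h ≤ h * q)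
  (12hn≤2^ℓt : 12 * h * n ≤ 2 ^ ℓ * t)
  (2≤h : 2 ≤ h)
  (2h<2^k : 2 * h < 2 ^ k)
  where

  N : ℕ
  N = 2 ^ ℓ

  instance
    N≢0 : NonZero N
    N≢0 = m^n≢0 2 ℓ

  grid : ℕ → ℕ
  grid i = i * n / N

  grid-mono : ∀ i → grid i ≤ grid (suc i)
  grid-mono i = /-monoˡ-≤ N (m≤n+m (i * n) n)

  -- The upper cut is rounded down, and rounding lowers `N * grid i` by less than `N` from `i * n`.
  grid-step : ∀ i → N * (grid (suc i) ∸ grid i) < N + n
  grid-step i = +-cancelʳ-< (N * grid i) _ _ (begin-strict
    N * (grid (suc i) ∸ grid i) + N * grid i  ≡⟨ *-distribˡ-+ N _ (grid i) ⟨
    N * (grid (suc i) ∸ grid i + grid i)      ≡⟨ cong (N *_) (m∸n+n≡m (grid-mono i)) ⟩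
    N * grid (suc i)                          ≡⟨ *-comm N _ ⟩
    grid (suc i) * N                          ≤⟨ m/n*n≤m (suc i * n) N ⟩
    n + i * n                                 <⟨ +-monoʳ-< n (m<1+m/n*n (i * n) N) ⟩
    n + (N + grid i * N)                      ≡⟨ rearrange n N (grid i) ⟩
    N + n + N * grid i                        ∎)
    where
    open ≤-Reasoning
    rearrange : ∀ n N g → n + (N + g * N) ≡ N + n + N * g
    rearrange = solve-∀

  -- Each player counts in units of t/2h, so that the median of A ∪ B has height about h.
  height : ℕ → Subset n → ℕ
  height i S = 2 * h * rank S (grid i) / t

  leaf : ℕ → Protocol (Subset n) (Subset n) (Fin n)
  leaf i = output (pick (grid i) (grid (suc i))) (pick (grid i) (grid (suc i)))

  open Search k h height height leaf

  Π : Protocol (Subset n) (Subset n) (Fin n)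
  Π = search ℓ 0

  module _ {A B : Subset n} (adm : Admissible t A B) where
    open Admissible adm

    S : Subset n
    S = A ∪ B

    rank-S : ∀ x → rank S x ≡ rank A x + rank B x
    rank-S = rank-∪ A B disjoint

    ∣S∣≡t : ∣ S ∣ ≡ t
    ∣S∣≡t = begin
      ∣ S ∣                ≡⟨ rank-full S ⟨
      rank S n             ≡⟨ rank-S n ⟩
      rank A n + rank B n  ≡⟨ cong₂ _+_ (rank-full A) (rank-full B) ⟩
      ∣ A ∣ + ∣ B ∣        ≡⟨ total ⟩
      t                    ∎
      where open ≡-Reasoning

    height-lower : ∀ i → (height i A + height i B) * t ≤ 2 * h * rank S (grid i)
    height-lower i = begin
      (height i A + height i B) * t                        ≡⟨ *-distribʳ-+ t (height i A) _ ⟩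
      height i A * t + height i B * t                      ≤⟨ +-mono-≤ (m/n*n≤m _ t) (m/n*n≤m _ t) ⟩
      2 * h * rank A (grid i) + 2 * h * rank B (grid i)    ≡⟨ *-distribˡ-+ (2 * h) (rank A (grid i)) _ ⟨
      2 * h * (rank A (grid i) + rank B (grid i))          ≡⟨ cong (2 * h *_) (rank-S (grid i)) ⟨
      2 * h * rank S (grid i)                              ∎
      where open ≤-Reasoning

    -- Each of the two roundings loses less than one unit, whence the 2.
    height-upper : ∀ i → 2 * h * rank S (grid i) < (2 + (height i A + height i B)) * t
    height-upper i = begin-strict
      2 * h * rank S (grid i)                              ≡⟨ cong (2 * h *_) (rank-S (grid i)) ⟩
      2 * h * (rank A (grid i) + rank B (grid i))          ≡⟨ *-distribˡ-+ (2 * h) (rank A (grid i)) _ ⟩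
      2 * h * rank A (grid i) + 2 * h * rank B (grid i)    <⟨ +-mono-< (m<1+m/n*n _ t) (m<1+m/n*n _ t) ⟩
      suc (height i A) * t + suc (height i B) * t          ≡⟨ rearrange (height i A) (height i B) t ⟩
      (2 + (height i A + height i B)) * t                  ∎
      where
      open ≤-Reasoning
      rearrange : ∀ a b t → suc a * t + suc b * t ≡ (2 + (a + b)) * t
      rearrange = solve-∀

    height< : ∀ i → height i A < 2 ^ k
    height< i = ≤-<-trans (begin
      2 * h * rank A (grid i) / t  ≤⟨ /-monoˡ-≤ t (*-monoʳ-≤ (2 * h) (≤-trans (rank≤∣S∣ A (grid i)) ∣A∣≤t)) ⟩
      2 * h * t / t                ≡⟨ m*n/n≡m (2 * h) t ⟩
      2 * h                        ∎) 2h<2^k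
      where
      open ≤-Reasoning
      ∣A∣≤t : ∣ A ∣ ≤ t
      ∣A∣≤t = subst (∣ A ∣ ≤_) total (m≤m+n ∣ A ∣ ∣ B ∣)

    height-start : height 0 A + height 0 B < h
    height-start = *-cancelʳ-< t _ h (begin-strict
      (height 0 A + height 0 B) * t  ≤⟨ height-lower 0 ⟩
      2 * h * rank S (0 / N)         ≡⟨ cong (λ x → 2 * h * rank S x) (0/n≡0 N) ⟩
      2 * h * rank S 0               ≡⟨ cong (2 * h *_) (rank-zero S) ⟩
      2 * h * 0                      ≡⟨ *-zeroʳ (2 * h) ⟩
      0                              <⟨ >-nonZero⁻¹ (h * t) {{m*n≢0 h t}} ⟩
      h * t                          ∎)
      where open ≤-Reasoning

    -- All `t` elements lie below the last cut, so the unrounded sum is 2h; rounding loses less than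
    -- 2, and 2 ≤ h.
    height-end : h ≤ height N A + height N B
    height-end = +-cancelˡ-≤ 2 h _ (<⇒≤ (begin-strict
      2 + h                          ≤⟨ +-monoˡ-≤ h 2≤h ⟩
      h + h                          ≡⟨ cong (h +_) (+-identityʳ h) ⟨
      2 * h                          <⟨ *-cancelʳ-< t _ _ 2ht< ⟩
      2 + (height N A + height N B)  ∎))
      where
      open ≤-Reasoning
      2ht< : 2 * h * t < (2 + (height N A + height N B)) * t
      2ht< = subst (λ r → 2 * h * r < (2 + (height N A + height N B)) * t) rank-end (height-upper N)
        where
        rank-end : rank S (grid N) ≡ t
        rank-end = trans (cong (rank S) (trans (cong (_/ N) (*-comm N n)) (m*n/n≡m n N)))
                         (trans (rank-full S) ∣S∣≡t)

    -- The lower end of the cell controls the elements above `e`, the upper end those below. Passing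
    -- from an end to `e` costs at most the width of the cell.
    in-cell : ∀ {i} → Crosses A B i (suc i) → ∀ {e} → e ∈ S →
      grid i ≤ toℕ e → toℕ e < grid (suc i) → Mediocre (p * t / q) (p * t / q) S e
    in-cell {i} (lo , hi) {e} e∈S i≤e e<i = mediocre e∈S
      (slack {p} 2q+2ph≤hq 12hn≤2^ℓt (grid-step i) (m/n*n≤m (p * t) q) above-lo above-e)
      (slack {p} 2q+2ph≤hq 12hn≤2^ℓt (grid-step i) (m/n*n≤m (p * t) q) below-hi below-e)
      where
      open ≤-Reasoning
      x = grid i
      y = grid (suc i)
      rank≤t : ∀ z → rank S z ≤ t
      rank≤t z = subst (rank S z ≤_) ∣S∣≡t (rank≤∣S∣ S z)

      below-hi : t * h ≤ 2 * h * rank S y + t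
      below-hi = begin
        t * h                                         ≡⟨ *-comm t h ⟩
        h * t                                         ≤⟨ *-monoˡ-≤ t hi ⟩
        (height (suc i) A + height (suc i) B) * t     ≤⟨ height-lower (suc i) ⟩
        -- On this side rounding helps and the rank reaches t/2; `t` is added to reach the form that
        -- `slack` takes for both sides.
        2 * h * rank S y                              ≤⟨ m≤m+n _ t ⟩
        2 * h * rank S y + t                          ∎

      below-e : rank S y ≤ ∣ S ∩ smaller e ∣ + (y ∸ x)
      below-e = begin
        rank S y                          ≤⟨ rank-lipschitz S (<⇒≤ e<i) ⟩
        rank S (toℕ e) + (y ∸ toℕ e)      ≤⟨ +-mono-≤ (≤-reflexive (sym (∣S∩smaller∣ S e))) (∸-monoʳ-≤ y i≤e) ⟩
        ∣ S ∩ smaller e ∣ + (y ∸ x)       ∎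

      above-lo : t * h ≤ 2 * h * (t ∸ rank S x) + t
      above-lo = +-cancelʳ-≤ (2 * h * rank S x) _ _ (begin
        t * h + 2 * h * rank S x                            ≤⟨ +-monoʳ-≤ (t * h) (<⇒≤ (height-upper i)) ⟩
        -- The sum is at most h - 1, so with the 2 for rounding it is at most h + 1.
        t * h + (2 + (height i A + height i B)) * t         ≤⟨ +-monoʳ-≤ (t * h) (*-monoˡ-≤ t (s≤s lo)) ⟩
        t * h + suc h * t                                   ≡⟨ split t h ⟩
        2 * h * t + t                                       ≡⟨ cong (λ u → 2 * h * u + t) (m∸n+n≡m (rank≤t x)) ⟨
        2 * h * (t ∸ rank S x + rank S x) + t               ≡⟨ distr (2 * h) (t ∸ rank S x) (rank S x) t ⟩
        2 * h * (t ∸ rank S x) + t + 2 * h * rank S x       ∎)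
        where
        split : ∀ t h → t * h + suc h * t ≡ 2 * h * t + t
        split = solve-∀
        distr : ∀ a b c t → a * (b + c) + t ≡ a * b + t + a * c
        distr = solve-∀

      above-e : t ∸ rank S x ≤ ∣ S ∩ greater e ∣ + (y ∸ x)
      above-e = m≤n+o⇒m∸n≤o t (rank S x) (begin
        t                                                  ≡⟨ ∣S∣≡t ⟨
        ∣ S ∣                                              ≡⟨ ∣S∩greater∣ S e ⟨
        ∣ S ∩ greater e ∣ + rank S (suc (toℕ e))
          ≤⟨ +-monoʳ-≤ _ (rank-lipschitz S (m≤n⇒m≤1+n i≤e)) ⟩
        ∣ S ∩ greater e ∣ + (rank S x + (suc (toℕ e) ∸ x))
          ≤⟨ +-monoʳ-≤ ∣ S ∩ greater e ∣ (+-monoʳ-≤ (rank S x) (∸-monoˡ-≤ x e<i)) ⟩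
        ∣ S ∩ greater e ∣ + (rank S x + (y ∸ x))           ≡⟨ rearrange ∣ S ∩ greater e ∣ (rank S x) (y ∸ x) ⟩
        rank S x + (∣ S ∩ greater e ∣ + (y ∸ x))           ∎)
        where
        rearrange : ∀ a b c → a + (b + c) ≡ b + (a + c)
        rearrange = solve-∀

    private
      searched : ∃[ i ] (Crosses A B i (suc i) × run Π A B ≡ run (leaf i) A B
                         × bits Π A B ≡ ℓ * suc k + 0)
      searched = search-correct height< ℓ 0 (height-start , height-end)

    bits-Π : bits Π A B ≤ ℓ * suc k
    bits-Π = let _ , _ , _ , b = searched in ≤-reflexive (trans b (+-identityʳ _))

    found : FoundByAtLeastOne (Mediocre (p * t / q) (p * t / q) S) (run Π A B)
    found with i , c , r , _ ← searched rewrite r =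
        Sum.map (nonempty A) (nonempty B) (m+n<o+p⇒m<o∨n<p (<-≤-trans (proj₁ c) (proj₂ c)))
      , MaybeAll.map (λ (e∈A , i≤e , e<i) → in-cell {i} c (x∈p∪q⁺ (inj₁ e∈A)) i≤e e<i) (pick-between _ _ A)
      , MaybeAll.map (λ (e∈B , i≤e , e<i) → in-cell {i} c (x∈p∪q⁺ (inj₂ e∈B)) i≤e e<i) (pick-between _ _ B)
      where
      nonempty : ∀ X → height i X < height (suc i) X → Is-just (pick (grid i) (grid (suc i)) X)
      -- Height is monotone in rank, so a growing height forces a growing rank.
      nonempty X lt = pick-just X (rank-<⇒∃∈ X (≰⇒> λ ge →
        <⇒≱ lt (/-monoˡ-≤ t (*-monoʳ-≤ (2 * h) ge))))

-- Complexity bounds and the theorem.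

-- The origin of the factor 3: a round of `suc k` bits has 2^(k+1) ≤ 8h, hence costs at most 3 log
-- h.
8h≤h³ : ∀ {h} → 3 ≤ h → 8 * h ≤ h ^ 3
8h≤h³ {h} 3≤h = begin
  8 * h          ≤⟨ *-monoˡ-≤ h (n≤1+n 8) ⟩
  3 * 3 * h      ≤⟨ *-monoˡ-≤ h (*-mono-≤ 3≤h 3≤h) ⟩
  h * h * h      ≡⟨ cube h ⟩
  h ^ 3          ∎
  where
  open ≤-Reasoning
  cube : ∀ h → h * h * h ≡ h * (h * (h * 1))
  cube = solve-∀

^-exchange : ∀ {a b k m} ℓ → a ^ k ≤ b ^ m → a ^ (ℓ * k) ≤ b ^ (m * ℓ)
^-exchange {a} {b} {k} {m} ℓ aᵏ≤bᵐ = begin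
  a ^ (ℓ * k)  ≡⟨ cong (a ^_) (*-comm ℓ k) ⟩
  a ^ (k * ℓ)  ≡⟨ ^-*-assoc a k ℓ ⟨
  (a ^ k) ^ ℓ  ≤⟨ ^-monoˡ-≤ ℓ aᵏ≤bᵐ ⟩
  (b ^ m) ^ ℓ  ≡⟨ ^-*-assoc b m ℓ ⟩
  b ^ (m * ℓ)  ∎
  where open ≤-Reasoning

mediocre-protocol : ∀ {p q h L ℓ n t} .{{_ : NonZero q}} → 0 < n →
  3 ≤ h → h ≤ 2 * q → 2 * q + 2 * p * h ≤ h * q → 12 * h * n ≤ 2 ^ ℓ * t → ℓ ≤ L →
  Σ[ Π ∈ Protocol (Subset n) (Subset n) (Fin n) ] Σ[ d ∈ ℕ ]
    ( FindsMediocre t (p * t / q) (p * t / q) Π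
    × ComplexityAtMost (Admissible t) Π d
    × d ≼ 3 * ℓ ·log₂ h
    × d ≤ L * (8 * (2 * q)))
-- For `t` zero the right side of `12hn≤2ˡt` vanishes while the left side is positive.
mediocre-protocol {h = suc _} {ℓ = ℓ} {n = suc _} {t = zero} _ _ _ _ 12hn≤2ˡt _
  rewrite *-zeroʳ (2 ^ ℓ) = contradiction 12hn≤2ˡt λ ()
mediocre-protocol {p} {q} {h@(suc _)} {L} {ℓ} {n} {t@(suc _)} 0<n 3≤h h≤2q 2q+2ph≤hq 12hn≤2ˡt ℓ≤L
  -- Alice's heights are at most 2h, so `k` bits hold them.
  with k , 2h<2ᵏ , 2ᵏ≤4h ← power-of-two (2 * h) =
    M.Π , ℓ * suc k , (λ _ _ → M.found) , (λ _ _ → M.bits-Π)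
  , ^-exchange {2} {h} {suc k} {3} ℓ (≤-trans 2¹⁺ᵏ≤8h (8h≤h³ 3≤h))
  , *-mono-≤ ℓ≤L (≤-trans (<⇒≤ (n<2^n (suc k))) (≤-trans 2¹⁺ᵏ≤8h (*-monoʳ-≤ 8 h≤2q)))
  where
  module M = MedianProtocol p q h ℓ k n t 2q+2ph≤hq 12hn≤2ˡt (<⇒≤ 3≤h) 2h<2ᵏ
  2¹⁺ᵏ≤8h : 2 ^ suc k ≤ 8 * h
  2¹⁺ᵏ≤8h = ≤-trans (*-monoʳ-≤ 2 2ᵏ≤4h) (≤-reflexive (double³ h))
    where
    double³ : ∀ h → 2 * (2 * (2 * h)) ≡ 8 * h
    double³ = solve-∀

theorem3 :
  Σ[ K ∈ ℕ ] (∀ (q : ℕ) .{{_ : NonZero q}} (c : ℝ) → Positive c → c · 1 ⊑ 1 →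
  Σ[ C ∈ ℕ ] (∀ (p : ℕ) → 0 < p → (2p<q : 2 * p < q) →
  ∀ (ℓ : ℕ) → ℓ ≡⌈log₂ 12 * h[ p , q , 2p<q ] / c ⌉ →
  ∀ (n t : ℕ) → 0 < n → c · n ⊑ t →
  Σ[ Π ∈ Protocol (Subset n) (Subset n) (Fin n) ] Σ[ d ∈ ℕ ]
    ( FindsMediocre t (p * t / q) (p * t / q) Π
    × ComplexityAtMost (Admissible t) Π d
    × d ≼ K * ℓ ·log₂ h[ p , q , 2p<q ]
    × d ≤ C )))
theorem3 = 3 , λ q c 0<c _ →
  -- Since 12h ≤ 24q, this `L` bounds every admissible `ℓ` and depends on `q` and `c` only.
  let L , 24q⊑2ᴸc = ⊑-2^ c 0<c (12 * (2 * q))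
  in L * (8 * (2 * q)) , λ p 0<p 2p<q ℓ (12h⊑2ˡc , ℓ-least) n t 0<n cn⊑t →
    mediocre-protocol {p} 0<n (3≤h 0<p 2p<q) (h≤2q 0<p 2p<q) (2q+2ph≤hq 0<p 2p<q)
      (⊑-cross c {12 * h[ p , q , 2p<q ]} (2 ^ ℓ) n {{m^n≢0 2 ℓ}} {{>-nonZero 0<n}} 12h⊑2ˡc cn⊑t)
      (ℓ-least L λ r up →
        ℚ.≤-trans (fromℕ-mono-≤ (*-monoʳ-≤ 12 (h≤2q 0<p 2p<q))) (24q⊑2ᴸc r up))
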